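{- For any fixed finite $L$, there exist a constant $C\ge 1$ and an algorithm that takes as input $m,n\in\mathbb{N}$ and a zero-set $\mathcal{Z}$ with $\mathcal{Z}\subseteq R_{a,b}\subseteq R_{n,m}$, returns a number in the interval $[\gamma^L,C\gamma^L]$, where $\gamma^L=\gamma^L(\mathcal{Z},m,n)$, and runs in time that is polynomial in $ab$.
   Context: $\mathbb{Z}_+=\{0,1,2,\dots\}$, $\mathbb{N}=\{1,2,\dots\}$, $[0,c]=\{0,1,\dots,c\}$, and, for integers $a,b\ge1$, $R_{a,b}=[0,a-1]\times[0,b-1]$. A zero-set (Young diagram) is a downward-closed set $\mathcal{Z}\subseteq\mathbb{Z}_+^2$. For $m,n\in\mathbb{N}$, the graph $K_m\Box K_n$ is represented on the vertex set $R_{n,m}=[0,n-1]\times[0,m-1]$, with two vertices adjacent iff they differ in exactly one coordinate. For $v=(j,i)\in R_{n,m}$, the row neighborhood $\mathcal{N}^r(v)$ is the set of all $(j',i)\in R_{n,m}$ with $j'\neq j$, and the column neighborhood $\mathcal{N}^c(v)$ is the set of all $(j,i')\in R_{n,m}$ with $i'\ne i$. Given $\mathcal{Z}$, for $A\subseteq R_{n,m}$ let $\mathcal{T}(A)=A\cup\{v\in R_{n,m}\setminus A\colon (|\mathcal{N}^r(v)\cap A|,|\mathcal{N}^c(v)\cap A|)\notin\mathcal{Z}\}$; $\mathcal{T}^L$ is the $L$-fold iterate, with $\mathcal{T}^0(A)=A$. For $L\in\mathbb{Z}_+$, $\gamma^L(\mathcal{Z},m,n)=\min\{|A|\colon A\subseteq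 R_{n,m},\ \mathcal{T}^L(A)=R_{n,m}\}$. Running time is counted in elementary arithmetic operations and comparisons on integers (unit cost). The constant $C$ and the polynomial may depend on $L$. -}

module Defs where

open import Data.Bool using (Bool; true; false; if_then_else_)
open import Data.Fin using (Fin; quotient; remainder)
import Data.Fin.Properties as Fin
open import Data.Fin.Subset using (Subset; _∩_; _∪_; ∣_∣; ⊤)
open import Data.Fin.Subset.Properties using (_∈?_; anySubset?; ∪-zeroˡ)
open import Data.Integer as ℤ using (ℤ; +_; -[1+_])
import Data.Integer.Properties as ℤ
open import Data.List using (List; foldr; length; filter; upTo)
open import Data.Nat using (ℕ; zero; suc; _+_; _*_; _≤_; _<_)
import Data.Nat.Properties as ℕ
open import Data.Product using (_×_; _,_; ∃; ∃-syntax; proj₁)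
open import Data.Sum using (_⊎_; inj₁; inj₂)
open import Data.Vec using (tabulate)
import Data.Vec.Properties as Vec
import Data.Bool.Properties as Bool
open import Level using (0ℓ)
open import Relation.Binary.PropositionalEquality
  using (_≡_; refl; trans; cong)
open import Relation.Nullary using (¬_; yes; no; does; contradiction)
open import Relation.Nullary.Decidable using (_×-dec_; ¬?)
open import Relation.Unary using (Pred; Decidable)

------------------------------------------------------------------------
-- Zero-sets

-- A zero-set is an input to an algorithm, so membership is decidable.
record ZeroSet : Set₁ where
  field
    Mem    : Pred (ℕ × ℕ) 0ℓ
    mem?   : Decidable Mem
    closed : ∀ {x y x′ y′} → x′ ≤ x → y′ ≤ y → Mem (x , y) → Mem (x′ , y′)

open ZeroSet public

R : ℕ → ℕ → Pred (ℕ × ℕ) 0ℓ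
R a b (x , y) = x < a × y < b

------------------------------------------------------------------------
-- Growth dynamics on K_m □ K_n

-- The vertex set [0,n-1] × [0,m-1] is Fin (n * m); v stands for the pair
-- (xcoord v , ycoord v), and v ↦ this pair is a bijection onto
-- Fin n × Fin m with inverse Data.Fin.combine.
Vertex : ℕ → ℕ → Set
Vertex n m = Fin (n * m)

VertexSet : ℕ → ℕ → Set
VertexSet n m = Subset (n * m)

module _ {n m : ℕ} where

  xcoord : Vertex n m → Fin n
  xcoord = quotient m

  ycoord : Vertex n m → Fin m
  ycoord = remainder {n} m

  comprehension : {P : Pred (Vertex n m) 0ℓ} → Decidable P → VertexSet n m
  comprehension P? = tabulate (λ v → does (P? v))

  𝒩ʳ : Vertex n m → VertexSet n m
  𝒩ʳ v = comprehension λ u →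
    ¬? (xcoord u Fin.≟ xcoord v) ×-dec (ycoord u Fin.≟ ycoord v)

  𝒩ᶜ : Vertex n m → VertexSet n m
  𝒩ᶜ v = comprehension λ u →
    (xcoord u Fin.≟ xcoord v) ×-dec ¬? (ycoord u Fin.≟ ycoord v)

  𝒯 : ZeroSet → VertexSet n m → VertexSet n m
  𝒯 Z A = A ∪ comprehension λ v →
    ¬? (v ∈? A) ×-dec ¬? (mem? Z (∣ 𝒩ʳ v ∩ A ∣ , ∣ 𝒩ᶜ v ∩ A ∣))

  𝒯^ : ℕ → ZeroSet → VertexSet n m → VertexSet n m
  𝒯^ zero    Z A = A
  𝒯^ (suc L) Z A = 𝒯 Z (𝒯^ L Z A)

  Spans : ℕ → ZeroSet → Pred (VertexSet n m) 0ℓ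
  Spans L Z A = 𝒯^ L Z A ≡ ⊤

record IsMinimum (P : Pred ℕ 0ℓ) (g : ℕ) : Set where
  field
    attained : P g
    minimal  : ∀ k → P k → g ≤ k

SpanningSize : ℕ → ZeroSet → ℕ → ℕ → Pred ℕ 0ℓ
SpanningSize L Z m n k =
  ∃[ A ] Spans {n} {m} L Z A × ∣ A ∣ ≡ k

minimum : {P : Pred ℕ 0ℓ} → Decidable P → ∃ P → ∃ (IsMinimum P)
minimum {P} P? (k , Pk) with search (suc k)
  where
  search : ∀ j → ∃ (IsMinimum P) ⊎ (∀ i → i < j → ¬ P i)
  search zero = inj₂ λ _ ()
  search (suc j) with search j
  ... | inj₁ found = inj₁ found
  ... | inj₂ none with P? j
  ...   | yes Pj = inj₁ (j , record
            { attained = Pj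
            ; minimal  = λ i Pi → ℕ.≮⇒≥ λ i<j → none i i<j Pi })
  ...   | no ¬Pj = inj₂ λ i i<1+j Pi →
            none i (ℕ.≤∧≢⇒< (ℕ.<⇒≤pred i<1+j) λ { refl → ¬Pj Pi }) Pi
... | inj₁ found = found
... | inj₂ none  = contradiction Pk (none k ℕ.≤-refl)

SpanningSize? : ∀ L Z m n → Decidable (SpanningSize L Z m n)
SpanningSize? L Z m n k = anySubset? λ A →
  Vec.≡-dec Bool._≟_ (𝒯^ {n} {m} L Z A) ⊤ ×-dec (∣ A ∣ ℕ.≟ k)

⊤-spans : ∀ L Z {m n} → Spans {n} {m} L Z ⊤
⊤-spans zero    Z = refl
⊤-spans (suc L) Z {m} {n} =
  trans (cong (𝒯 {n} {m} Z) (⊤-spans L Z {m} {n})) (∪-zeroˡ _)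

γ-exists : ∀ L Z m n → ∃ (IsMinimum (SpanningSize L Z m n))
γ-exists L Z m n =
  minimum (SpanningSize? L Z m n) (∣ ⊤ {n * m} ∣ , ⊤ , ⊤-spans L Z {m} {n} , refl)

γ : ℕ → ZeroSet → ℕ → ℕ → ℕ
γ L Z m n = proj₁ (γ-exists L Z m n)

------------------------------------------------------------------------
-- Algorithms: a random access machine over ℤ with unit-cost arithmetic,
-- programmed in a structured language

-- A fixed program mentions finitely many arrays, each holding one integer
-- per integer index; a scalar variable is an array used at one index only.
State : Set
State = ℕ → ℤ → ℤ

update : State → ℕ → ℤ → ℤ → State
update σ a i x a′ i′ =
  if does (a ℕ.≟ a′) then (if does (i ℤ.≟ i′) then x else σ a′ i′) else σ a′ i′

data Op : Set where
  add sub mul div : Op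

-- Euclidean division; dividing by zero gives zero.
quot : ℤ → ℤ → ℤ
quot i (+ zero)    = + 0
quot i j@(+ suc _) = i ℤ./ j
quot i j@(-[1+ _ ]) = i ℤ./ j

⟦_⟧ᵒ : Op → ℤ → ℤ → ℤ
⟦ add ⟧ᵒ = ℤ._+_
⟦ sub ⟧ᵒ = ℤ._-_
⟦ mul ⟧ᵒ = ℤ._*_
⟦ div ⟧ᵒ = quot

data Expr : Set where
  lit  : ℤ → Expr
  read : ℕ → Expr → Expr
  op   : Op → Expr → Expr → Expr

eval : State → Expr → ℤ
eval σ (lit x)      = x
eval σ (read a e)   = σ a (eval σ e)
eval σ (op o e₁ e₂) = ⟦ o ⟧ᵒ (eval σ e₁) (eval σ e₂)

exprCost : Expr → ℕ
exprCost (lit x)      = 1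
exprCost (read a e)   = 1 + exprCost e
exprCost (op o e₁ e₂) = 1 + (exprCost e₁ + exprCost e₂)

data Rel : Set where
  lt le eq : Rel

data Test : Set where
  cmp : Rel → Expr → Expr → Test

⟦_⟧ʳ : Rel → ℤ → ℤ → Bool
⟦ lt ⟧ʳ i j = does (i ℤ.<? j)
⟦ le ⟧ʳ i j = does (i ℤ.≤? j)
⟦ eq ⟧ʳ i j = does (i ℤ.≟ j)

holds : State → Test → Bool
holds σ (cmp r e₁ e₂) = ⟦ r ⟧ʳ (eval σ e₁) (eval σ e₂)

testCost : Test → ℕ
testCost (cmp r e₁ e₂) = 1 + (exprCost e₁ + exprCost e₂)

infixr 5 _⨾_

data Program : Set where
  skip  : Program
  write : ℕ → Expr → Expr → Program
  _⨾_   : Program → Program → Program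
  cond  : Test → Program → Program → Program
  while : Test → Program → Program

infix 4 ⟨_,_⟩⇓[_]_

-- ⟨ p , σ ⟩⇓[ t ] τ : started in σ, p halts in τ after t operations.  The
-- relation is deterministic.  Besides arithmetic and comparisons, t also
-- counts literals, memory accesses and no-ops.
data ⟨_,_⟩⇓[_]_ : Program → State → ℕ → State → Set where
  ⇓skip   : ∀ {σ} → ⟨ skip , σ ⟩⇓[ 1 ] σ
  ⇓write  : ∀ {σ a e₁ e₂} →
            ⟨ write a e₁ e₂ , σ ⟩⇓[ 1 + (exprCost e₁ + exprCost e₂) ]
              update σ a (eval σ e₁) (eval σ e₂)
  ⇓seq    : ∀ {σ σ′ τ p q s t} →
            ⟨ p , σ ⟩⇓[ s ] σ′ → ⟨ q , σ′ ⟩⇓[ t ] τ →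
            ⟨ p ⨾ q , σ ⟩⇓[ s + t ] τ
  ⇓true   : ∀ {σ τ c p q t} → holds σ c ≡ true →
            ⟨ p , σ ⟩⇓[ t ] τ → ⟨ cond c p q , σ ⟩⇓[ testCost c + t ] τ
  ⇓false  : ∀ {σ τ c p q t} → holds σ c ≡ false →
            ⟨ q , σ ⟩⇓[ t ] τ → ⟨ cond c p q , σ ⟩⇓[ testCost c + t ] τ
  ⇓done   : ∀ {σ c p} → holds σ c ≡ false →
            ⟨ while c p , σ ⟩⇓[ testCost c ] σ
  ⇓loop   : ∀ {σ σ′ τ c p s t} → holds σ c ≡ true →
            ⟨ p , σ ⟩⇓[ s ] σ′ → ⟨ while c p , σ′ ⟩⇓[ t ] τ →
            ⟨ while c p , σ ⟩⇓[ testCost c + (s + t) ] τ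

-- |{ y < m : (x , y) ∈ Z }|; when Z ⊆ R n m, the pairs (x , y) in Z are
-- exactly those with y < height Z m x.
height : ZeroSet → ℕ → ℕ → ℕ
height Z m x = length (filter (λ y → mem? Z (x , y)) (upTo m))

-- Initial memory: m, n, and the Young diagram given by its column heights.
-- The rectangle R a b is not part of the input.
input : ℕ → ℕ → ZeroSet → State
input m n Z 0 (+ 0) = + m
input m n Z 1 (+ 0) = + n
input m n Z 2 (+ x) = + height Z m x
input m n Z _ _     = + 0

output : State → ℤ
output τ = τ 0 (+ 0)

-- c₀ + c₁ x + c₂ x² + ⋯ for the coefficient list c₀ ∷ c₁ ∷ c₂ ∷ ⋯
polynomial : List ℕ → ℕ → ℕ
polynomial cs x = foldr (λ c r → c + x * r) 0 cs

{-# OPTIONS --safe #-}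
module Submission where

-- Let E₀(x,k) = xk and E_{t+1}(x,k) = min(xk, min_{(u,w) ∉ Z} E_t(u,k) + E_t(x,w)).
-- If a u × k and an x × w rectangle with (u,w) ∉ Z are filled after t steps,
-- then the x × k rectangle is filled one step later; hence γ^L ≤ E_L(n,m).
-- Conversely E_L(n,m) ≤ 4^L γ^L: tracing a spanning set back in time, each step
-- loses a factor 2 in the number of rows and a factor 2 in their occupation.
-- Since E_t is monotone, u ≤ a and w = height u suffice in the minimum, so the
-- recursion evaluates E_L(n,m) in time O(a^L) for fixed L.

open import Defs
open import Data.Bool using (Bool; true)
import Data.Bool.Properties as Bool
open import Data.Fin as Fin using (Fin; zero; suc)
import Data.Fin.Properties as Fin
open import Data.Fin.Subset
  using (Subset; inside; outside; _∈_; _∉_; ∣_∣; ⊤; _∪_; _∩_)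
  renaming (_⊆_ to _⊆ˢ_)
open import Data.Fin.Subset.Properties
  using (∣p∣≤n; _∈?_; ∈⊤; ∣⊤∣≡n; p⊆q⇒∣p∣≤∣q∣; p⊆p∪q; q⊆p∪q; x∈p∩q⁺; x∈p∩q⁻;
         x∈p∪q⁺; x∈p∪q⁻; ⊆-antisym; ⊆-max)
open import Data.Integer as ℤ using (ℤ; +_)
import Data.Integer.Properties as ℤ
open import Data.List using (List; []; _∷_; map; length; filter; applyUpTo; upTo)
import Data.List.Properties as List
open import Data.Nat
  using (ℕ; zero; suc; _+_; _*_; _^_; _≤_; _<_; _⊓_; _≤?_; _<?_; z≤n; s≤s; z<s)
import Data.Nat.Properties as ℕ
open import Data.Nat.Tactic.RingSolver using (solve-∀)
open import Data.Product using (_×_; _,_; ∃-syntax; proj₁; proj₂)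
open import Data.Sum using (_⊎_; inj₁; inj₂)
open import Data.Vec using ([]; _∷_; tabulate; lookup; here; there)
open import Data.Vec.Properties using (lookup∘tabulate; []=⇒lookup; lookup⇒[]=)
open import Function using (_∘_; flip; id)
open import Level using (0ℓ)
open import Relation.Binary.PropositionalEquality
  using (_≡_; _≢_; refl; sym; trans; cong; cong₂; subst; subst₂)
open import Relation.Nullary using (¬_; yes; no; does; contradiction)
open import Relation.Nullary.Decidable
  using (_×-dec_; ¬?; dec-true; dec-false)
open import Relation.Unary using (Pred; Decidable; _⊆_)

-- The loss per step stays bounded because fillings tolerate rescaling: stretching one side of a
-- rectangle by an integer factor raises the cost by at most that factor. So each halving is undone
-- at the price of a factor 2. Either both halvings fall on a directly filled rectangle, giving 2 ·
-- 2, or each falls on one of the two smaller rectangles of a step, giving 2 + 2; both are 4. The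
-- time bound must not involve m and n, which may be far larger than ab, and the program is not told
-- a. Hence m and n enter through arithmetic only, and the search over u stops at the first empty
-- column of Z. E_t appears as an inductive family of achievable costs over an arbitrary relation
-- `G`. Proofs can then follow the way of filling, minima are only needed for the program, and
-- passing to `flip G` exchanges rows and columns.

private variable
  M N p q : ℕ

-- Counting in subsets of Fin N

enum : (S : Subset N) → Fin ∣ S ∣ → Fin N
enum (inside  ∷ S) zero    = zero
enum (inside  ∷ S) (suc k) = suc (enum S k)
enum (outside ∷ S) k       = suc (enum S k)

enum-∈ : (S : Subset N) (k : Fin ∣ S ∣) → enum S k ∈ S
enum-∈ (inside  ∷ S) zero    = here
enum-∈ (inside  ∷ S) (suc k) = there (enum-∈ S k)
enum-∈ (outside ∷ S) k       = there (enum-∈ S k)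

enum-injective : (S : Subset N) {k l : Fin ∣ S ∣} → enum S k ≡ enum S l → k ≡ l
enum-injective (inside  ∷ S) {zero}  {zero}  eq′ = refl
enum-injective (inside  ∷ S) {suc k} {suc l} eq′ =
  cong suc (enum-injective S (Fin.suc-injective eq′))
enum-injective (outside ∷ S) eq′ = enum-injective S (Fin.suc-injective eq′)

index : {S : Subset N} {i : Fin N} → i ∈ S → Fin ∣ S ∣
index {S = inside  ∷ S} here        = zero
index {S = inside  ∷ S} (there i∈S) = suc (index i∈S)
index {S = outside ∷ S} (there i∈S) = index i∈S

enum-index : {S : Subset N} {i : Fin N} (i∈S : i ∈ S) → enum S (index i∈S) ≡ i
enum-index {S = inside  ∷ S} here        = refl
enum-index {S = inside  ∷ S} (there i∈S) = cong suc (enum-index i∈S)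
enum-index {S = outside ∷ S} (there i∈S) = cong suc (enum-index i∈S)

-- Numbering both subsets reduces this to injections between finite types. `g` receives the
-- membership proof, so it may be defined on `S` alone.
injection⇒∣∣≤ : (S : Subset M) (T : Subset N) (g : ∀ {i} → i ∈ S → Fin N) →
  (∀ {i} (i∈S : i ∈ S) → g i∈S ∈ T) →
  (∀ {i j} (i∈S : i ∈ S) (j∈S : j ∈ S) → g i∈S ≡ g j∈S → i ≡ j) →
  ∣ S ∣ ≤ ∣ T ∣
injection⇒∣∣≤ S T g g∈T g-injective =
  Fin.injective⇒≤ {f = λ k → index (g∈T (enum-∈ S k))} λ {k} {l} eq′ →
    enum-injective S (g-injective (enum-∈ S k) (enum-∈ S l)
      (trans (sym (enum-index (g∈T (enum-∈ S k))))
        (trans (cong (enum T) eq′) (enum-index (g∈T (enum-∈ S l))))))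

embedding⇒≤∣∣ : (T : Subset N) (f : Fin M → Fin N) → (∀ k → f k ∈ T) →
  (∀ {k l} → f k ≡ f l → k ≡ l) → M ≤ ∣ T ∣
embedding⇒≤∣∣ {M = M} T f f∈T f-injective = subst (_≤ ∣ T ∣) (∣⊤∣≡n M)
  (injection⇒∣∣≤ ⊤ T (λ {k} _ → f k) (λ {k} _ → f∈T k) λ _ _ → f-injective)

∣p∪q∣≤∣p∣+∣q∣ : (S T : Subset N) → ∣ S ∪ T ∣ ≤ ∣ S ∣ + ∣ T ∣
∣p∪q∣≤∣p∣+∣q∣ []            []            = z≤n
∣p∪q∣≤∣p∣+∣q∣ (inside  ∷ S) (inside  ∷ T) =
  s≤s (ℕ.≤-trans (∣p∪q∣≤∣p∣+∣q∣ S T) (ℕ.+-monoʳ-≤ ∣ S ∣ (ℕ.n≤1+n ∣ T ∣)))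
∣p∪q∣≤∣p∣+∣q∣ (inside  ∷ S) (outside ∷ T) = s≤s (∣p∪q∣≤∣p∣+∣q∣ S T)
∣p∪q∣≤∣p∣+∣q∣ (outside ∷ S) (inside  ∷ T) =
  ℕ.≤-trans (s≤s (∣p∪q∣≤∣p∣+∣q∣ S T)) (ℕ.≤-reflexive (sym (ℕ.+-suc ∣ S ∣ ∣ T ∣)))
∣p∪q∣≤∣p∣+∣q∣ (outside ∷ S) (outside ∷ T) = ∣p∪q∣≤∣p∣+∣q∣ S T

argmin : (S : Subset N) (f : Fin N → ℕ) →
  ∣ S ∣ ≡ 0 ⊎ (∃[ i ] i ∈ S × (∀ {j} → j ∈ S → f i ≤ f j))
argmin []            f = inj₁ refl
argmin (outside ∷ S) f with argmin S (f ∘ suc)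
... | inj₁ empty           = inj₁ empty
... | inj₂ (i , i∈S , min) = inj₂ (suc i , there i∈S , λ { (there j∈S) → min j∈S })
argmin (inside ∷ S) f with argmin S (f ∘ suc)
... | inj₁ empty = inj₂ (zero , here , λ where
        here        → ℕ.≤-refl
        (there j∈S) → contradiction (subst Fin empty (index j∈S)) λ ())
... | inj₂ (i , i∈S , min) with ℕ.≤-total (f zero) (f (suc i))
...   | inj₁ 0≤i = inj₂ (zero , here , λ where
          here        → ℕ.≤-refl
          (there j∈S) → ℕ.≤-trans 0≤i (min j∈S))
...   | inj₂ i≤0 = inj₂ (suc i , there i∈S , λ where
          here        → i≤0
          (there j∈S) → min j∈S)

tabulate-∈⁺ : {f : Fin N → Bool} {i : Fin N} → f i ≡ true → i ∈ tabulate f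
tabulate-∈⁺ {f = f} {i} eq′ = lookup⇒[]= i _ (trans (lookup∘tabulate f i) eq′)

tabulate-∈⁻ : {f : Fin N → Bool} {i : Fin N} → i ∈ tabulate f → f i ≡ true
tabulate-∈⁻ {f = f} {i} i∈ = trans (sym (lookup∘tabulate f i)) ([]=⇒lookup i∈)

collect : {P : Pred (Fin N) 0ℓ} → Decidable P → Subset N
collect P? = tabulate (does ∘ P?)

collect⁺ : {P : Pred (Fin N) 0ℓ} (P? : Decidable P) {i : Fin N} → P i → i ∈ collect P?
collect⁺ P? {i} Pi = tabulate-∈⁺ (dec-true (P? i) Pi)

collect⁻ : {P : Pred (Fin N) 0ℓ} (P? : Decidable P) {i : Fin N} → i ∈ collect P? → P i
collect⁻ P? {i} i∈ with P? i | tabulate-∈⁻ {f = does ∘ P?} i∈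
... | yes Pi | _  = Pi
... | no _   | ()

∣preimage∣-mono : {S T : Subset N} → S ⊆ˢ T → (e : Fin M → Fin N) →
  ∣ tabulate (lookup S ∘ e) ∣ ≤ ∣ tabulate (lookup T ∘ e) ∣
∣preimage∣-mono {S = S} {T} S⊆T e =
  p⊆q⇒∣p∣≤∣q∣ {p = tabulate (lookup S ∘ e)} {tabulate (lookup T ∘ e)} λ {i} i∈ →
    tabulate-∈⁺ ([]=⇒lookup (S⊆T (lookup⇒[]= (e i) S (tabulate-∈⁻ i∈))))

-- The pairs of a line in `I` and one of its first `x` points in `A` embed into `A`. Leaving the
-- parametrization `e` open makes one count serve rows and columns.
lines-bound : (e : Fin p → Fin q → Fin N) →
  (∀ i j i′ j′ → e i j ≡ e i′ j′ → i ≡ i′ × j ≡ j′) →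
  (A : Subset N) (I : Subset p) (x : ℕ) →
  (∀ {i} → i ∈ I → x ≤ ∣ tabulate (λ j → lookup A (e i j)) ∣) →
  x * ∣ I ∣ ≤ ∣ A ∣
lines-bound {p} {q} {N} e e-injective A I x x≤ =
  subst (_≤ ∣ A ∣) (ℕ.*-comm ∣ I ∣ x)
    (embedding⇒≤∣∣ A point point∈A (point-injective _ _))
  where
  line : Fin p → Subset q
  line i = tabulate (λ j → lookup A (e i j))

  row : Fin (∣ I ∣ * x) → Fin p
  row c = enum I (Fin.quotient x c)

  x≤line : ∀ c → x ≤ ∣ line (row c) ∣
  x≤line c = x≤ (enum-∈ I (Fin.quotient x c))

  place : ∀ c → Fin ∣ line (row c) ∣
  place c = Fin.inject≤ (Fin.remainder {∣ I ∣} x c) (x≤line c)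

  point : Fin (∣ I ∣ * x) → Fin N
  point c = e (row c) (enum (line (row c)) (place c))

  point∈A : ∀ c → point c ∈ A
  point∈A c = lookup⇒[]= (point c) A (tabulate-∈⁻ (enum-∈ (line (row c)) (place c)))

  -- The two positions have different types until the lines are identified, so the equation between
  -- the lines is an argument to be matched.
  same-place : ∀ {i i′} → i ≡ i′ → ∀ (l l′ : Fin x) x≤i x≤i′ →
    enum (line i) (Fin.inject≤ l x≤i) ≡ enum (line i′) (Fin.inject≤ l′ x≤i′) → l ≡ l′
  same-place refl l l′ x≤i x≤i′ eq′ =
    Fin.inject≤-injective x≤i x≤i′ l l′ (enum-injective (line _) eq′)

  point-injective : ∀ c d → point c ≡ point d → c ≡ d
  point-injective c d eq′ with e-injective _ _ _ _ eq′
  ... | row≡ , place≡ =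
    trans (sym (Fin.combine-remQuot {∣ I ∣} x c))
      (trans (cong₂ Fin.combine (enum-injective I row≡)
                (same-place row≡ _ _ (x≤line c) (x≤line d) place≡))
        (Fin.combine-remQuot {∣ I ∣} x d))

-- Filling costs

-- Fill G t x k c: an x × k rectangle can be filled in t steps at cost c,
-- where G u w means that u neighbors in the row and w in the column suffice.
data Fill (G : ℕ → ℕ → Set) : ℕ → ℕ → ℕ → ℕ → Set where
  fill : ∀ {t x k} → Fill G t x k (x * k)
  step : ∀ {t x k u w c d} → G u w → Fill G t u k c → Fill G t x w d →
         Fill G (suc t) x k (c + d)

Fill-transpose : ∀ {G t x k c} → Fill (flip G) t k x c → Fill G t x k c
Fill-transpose {x = x} {k} fill = subst (Fill _ _ x k) (ℕ.*-comm x k) fill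
Fill-transpose {x = x} {k} (step {c = c} {d} g F F′) =
  subst (Fill _ _ x k) (ℕ.+-comm d c) (step g (Fill-transpose F′) (Fill-transpose F))

-- In a step only the `x × w` part depends on `x`. The `u × k` part is kept, and its cost `c` is at
-- most `suc s * c` because the factor is positive.
Fill-scaleˡ : ∀ {G t x x′ k c} s → x ≤ suc s * x′ → Fill G t x′ k c →
  ∃[ d ] Fill G t x k d × d ≤ suc s * c
Fill-scaleˡ {x = x} {x′} {k} s x≤ fill =
  x * k , fill , ℕ.≤-trans (ℕ.*-monoˡ-≤ k x≤) (ℕ.≤-reflexive (ℕ.*-assoc (suc s) x′ k))
Fill-scaleˡ s x≤ (step {c = c} {d} g F F′) with Fill-scaleˡ s x≤ F′
... | d′ , G′ , d′≤ = c + d′ , step g F G′ ,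
  ℕ.≤-trans (ℕ.+-mono-≤ (ℕ.m≤n*m c (suc s)) d′≤)
    (ℕ.≤-reflexive (sym (ℕ.*-distribˡ-+ (suc s) c d)))

Fill-scaleʳ : ∀ {G t x k k′ c} s → k ≤ suc s * k′ → Fill G t x k′ c →
  ∃[ d ] Fill G t x k d × d ≤ suc s * c
Fill-scaleʳ s k≤ F with Fill-scaleˡ s k≤ (Fill-transpose F)
... | d , F′ , d≤ = d , Fill-transpose F′ , d≤

Fill-mono : ∀ {G t x x′ k k′ c} → x ≤ x′ → k ≤ k′ → Fill G t x′ k′ c →
  ∃[ d ] Fill G t x k d × d ≤ c
Fill-mono {x′ = x′} {k′ = k′} {c} x≤ k≤ F
  with Fill-scaleˡ 0 (ℕ.≤-trans x≤ (ℕ.m≤n*m x′ 1)) F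
... | d , F₁ , d≤ with Fill-scaleʳ 0 (ℕ.≤-trans k≤ (ℕ.m≤n*m k′ 1)) F₁
...   | d′ , F₂ , d′≤ = d′ , F₂ ,
  subst (d′ ≤_) (trans (ℕ.*-identityˡ _) (ℕ.*-identityˡ c))
    (ℕ.≤-trans d′≤ (ℕ.*-monoʳ-≤ 1 d≤))

half : ∀ {x} a b → x ≤ a + b → x ≤ 2 * a ⊎ x ≤ 2 * b
half {x} a b x≤ with ℕ.≤-total a b
... | inj₁ a≤b = inj₂ (ℕ.≤-trans x≤ (ℕ.+-mono-≤ a≤b (ℕ.m≤m+n b 0)))
... | inj₂ b≤a = inj₁ (ℕ.≤-trans x≤ (ℕ.+-monoʳ-≤ a (ℕ.≤-trans b≤a (ℕ.m≤m+n a 0))))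

-- B t i j says whether the point in row i and column j is occupied at time t.
record Growth (M : ℕ) (G : ℕ → ℕ → Set) (B : ℕ → Fin p → Fin q → Bool) : Set where
  field
    rows : ∀ (I : Subset p) x →
      (∀ {i} → i ∈ I → x ≤ ∣ tabulate (B 0 i) ∣) → x * ∣ I ∣ ≤ M
    cols : ∀ (J : Subset q) y →
      (∀ {j} → j ∈ J → y ≤ ∣ tabulate (flip (B 0) j) ∣) → y * ∣ J ∣ ≤ M
    grow : ∀ t {i j} → B (suc t) i j ≡ true →
      B 0 i j ≡ true ⊎ G ∣ tabulate (B t i) ∣ ∣ tabulate (flip (B t) j) ∣

-- Lets the induction of `fill-bound`, stated for rows, be applied to columns.
Growth-transpose : ∀ {G} {B : ℕ → Fin p → Fin q → Bool} →
  Growth M G B → Growth M (flip G) (λ t → flip (B t))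
Growth-transpose E = record { rows = cols ; cols = rows ; grow = λ t → grow t }
  where open Growth E

-- Of ∣ I ∣ rows with x points at time t + 1, half have x / 2 points at time 0,
-- or half have x / 2 points that became occupied later.  In the second case let
-- u be the least number of points at time t in these rows, and w the least
-- number of points at time t in the columns of the new points of a row that
-- attains u: then G u w, and the induction hypothesis applies to these rows
-- and to these columns.
fill-bound : ∀ {G} {B : ℕ → Fin p → Fin q → Bool} → Growth M G B →
  ∀ t (I : Subset p) x → (∀ {i} → i ∈ I → x ≤ ∣ tabulate (B t i) ∣) →
  ∃[ c ] Fill G t x ∣ I ∣ c × c ≤ 4 ^ t * M
fill-bound {M = M} E zero I x x≤ =
  x * ∣ I ∣ , fill , ℕ.≤-trans (Growth.rows E I x x≤) (ℕ.m≤n*m M 1)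
fill-bound {p} {q} {M} {G} {B} E (suc t) I x x≤ =
  result (half ∣ I₁ ∣ ∣ I₂ ∣ (ℕ.≤-trans (p⊆q⇒∣p∣≤∣q∣ I⊆) (∣p∪q∣≤∣p∣+∣q∣ I₁ I₂)))
  where
  open Growth E

  old? : ∀ i → Decidable (λ j → B (suc t) i j ≡ true × ¬ B 0 i j ≡ true)
  old? i j = (B (suc t) i j Bool.≟ true) ×-dec ¬? (B 0 i j Bool.≟ true)

  new : Fin p → Subset q
  new i = collect (old? i)

  row⊆ : ∀ i → tabulate (B (suc t) i) ⊆ˢ tabulate (B 0 i) ∪ new i
  row⊆ i {j} j∈ with B 0 i j Bool.≟ true
  ... | yes b = x∈p∪q⁺ (inj₁ (tabulate-∈⁺ b))
  ... | no ¬b = x∈p∪q⁺ (inj₂ (collect⁺ (old? i) (tabulate-∈⁻ j∈ , ¬b)))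

  I₁? : Decidable (λ i → x ≤ 2 * ∣ tabulate (B 0 i) ∣)
  I₁? i = x ≤? 2 * ∣ tabulate (B 0 i) ∣

  I₂? : Decidable (λ i → i ∈ I × x ≤ 2 * ∣ new i ∣)
  I₂? i = (i ∈? I) ×-dec (x ≤? 2 * ∣ new i ∣)

  I₁ I₂ : Subset p
  I₁ = collect I₁?
  I₂ = collect I₂?

  I⊆ : I ⊆ˢ I₁ ∪ I₂
  I⊆ {i} i∈I with half ∣ tabulate (B 0 i) ∣ ∣ new i ∣
    (ℕ.≤-trans (x≤ i∈I) (ℕ.≤-trans (p⊆q⇒∣p∣≤∣q∣ (row⊆ i))
      (∣p∪q∣≤∣p∣+∣q∣ (tabulate (B 0 i)) (new i))))
  ... | inj₁ l = x∈p∪q⁺ (inj₁ (collect⁺ I₁? l))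
  ... | inj₂ l = x∈p∪q⁺ (inj₂ (collect⁺ I₂? (i∈I , l)))

  Goal : Set
  Goal = ∃[ c ] Fill G (suc t) x ∣ I ∣ c × c ≤ 4 ^ suc t * M

  no-rows : ∣ I ∣ ≤ 0 → Goal
  no-rows l = x * ∣ I ∣ , fill ,
    subst (_≤ 4 ^ suc t * M) (sym (trans (cong (x *_) (ℕ.n≤0⇒n≡0 l)) (ℕ.*-zeroʳ x))) z≤n

  result : ∣ I ∣ ≤ 2 * ∣ I₁ ∣ ⊎ ∣ I ∣ ≤ 2 * ∣ I₂ ∣ → Goal
  -- Using the least count `r` in `I₁` avoids rounding `x / 2`: it satisfies both `x ≤ 2 * r` and
  -- the hypothesis of `rows`.
  result (inj₁ I≤) with argmin I₁ (λ i → ∣ tabulate (B 0 i) ∣)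
  ... | inj₁ empty = no-rows (subst (λ z → ∣ I ∣ ≤ 2 * z) empty I≤)
  ... | inj₂ (i , i∈I₁ , min) = x * ∣ I ∣ , fill , (begin
      x * ∣ I ∣                ≤⟨ ℕ.*-mono-≤ (collect⁻ I₁? i∈I₁) I≤ ⟩
      2 * r * (2 * ∣ I₁ ∣)     ≡⟨ rearrange r ∣ I₁ ∣ ⟩
      4 * (r * ∣ I₁ ∣)         ≤⟨ ℕ.*-monoʳ-≤ 4 (rows I₁ r min) ⟩
      4 * M                    ≤⟨ ℕ.*-monoˡ-≤ M (ℕ.*-monoʳ-≤ 4 (ℕ.m^n>0 4 t)) ⟩
      4 ^ suc t * M            ∎)
    where
    open ℕ.≤-Reasoning
    r = ∣ tabulate (B 0 i) ∣
    rearrange : ∀ a b → 2 * a * (2 * b) ≡ 4 * (a * b)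
    rearrange = solve-∀
  result (inj₂ I≤) with argmin I₂ (λ i → ∣ tabulate (B t i) ∣)
  ... | inj₁ empty = no-rows (subst (λ z → ∣ I ∣ ≤ 2 * z) empty I≤)
  ... | inj₂ (i , i∈I₂ , minᵢ) with argmin (new i) (λ j → ∣ tabulate (flip (B t) j) ∣)
  ...   | inj₁ empty = x * ∣ I ∣ , fill ,
            subst (λ z → z * ∣ I ∣ ≤ _)
              (sym (ℕ.n≤0⇒n≡0 (subst (λ z → x ≤ 2 * z) empty (proj₂ (collect⁻ I₂? i∈I₂))))) z≤n
  ...   | inj₂ (j , j∈new , minⱼ)
    with fill-bound E t I₂ _ minᵢ | fill-bound (Growth-transpose E) t (new i) _ minⱼ
  ...     | c , F , c≤ | d , F′ , d≤
    -- `F` is stretched from `I₂` back to all of `I`, and the transpose of `F′` from the new points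
    -- back to `x`; each costs one factor 2.
    with Fill-scaleʳ 1 I≤ F | Fill-scaleˡ 1 (proj₂ (collect⁻ I₂? i∈I₂)) (Fill-transpose F′)
  ...       | c′ , F₁ , c′≤ | d′ , F₁′ , d′≤ = c′ + d′ , step suffices F₁ F₁′ , (begin
      c′ + d′                            ≤⟨ ℕ.+-mono-≤ c′≤ d′≤ ⟩
      2 * c + 2 * d                      ≤⟨ ℕ.+-mono-≤ (ℕ.*-monoʳ-≤ 2 c≤) (ℕ.*-monoʳ-≤ 2 d≤) ⟩
      2 * (4 ^ t * M) + 2 * (4 ^ t * M)  ≡⟨ rearrange (4 ^ t) M ⟩
      4 ^ suc t * M                      ∎)
    where
    open ℕ.≤-Reasoning
    rearrange : ∀ a b → 2 * (a * b) + 2 * (a * b) ≡ 4 * a * b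
    rearrange = solve-∀
    suffices : G ∣ tabulate (B t i) ∣ ∣ tabulate (flip (B t) j) ∣
    suffices with collect⁻ (old? i) j∈new
    ... | b , ¬b₀ with grow t b
    ...   | inj₁ b₀ = contradiction b₀ ¬b₀
    ...   | inj₂ g  = g

-- Spanning sets

-- The bounds by `n` and `m` make both rectangles of a step fit into the grid.
Grow : ZeroSet → ℕ → ℕ → ℕ → ℕ → Set
Grow Z n m u w = u ≤ n × w ≤ m × ¬ Mem Z (u , w)

module _ (Z : ZeroSet) (n m : ℕ) where

  private
    X : Vertex n m → Fin n
    X = xcoord {n} {m}

    Y : Vertex n m → Fin m
    Y = ycoord {n} {m}

    T : ℕ → VertexSet n m → VertexSet n m
    T t = 𝒯^ {n} {m} t Z

    point : Fin n → Fin m → Vertex n m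
    point = Fin.combine

    X-point : ∀ j i → X (point j i) ≡ j
    X-point j i = cong proj₁ (Fin.remQuot-combine j i)

    Y-point : ∀ j i → Y (point j i) ≡ i
    Y-point j i = cong proj₂ (Fin.remQuot-combine j i)

    point-XY : ∀ v → point (X v) (Y v) ≡ v
    point-XY = Fin.combine-remQuot {n} m

    ext : ∀ {v v′} → X v ≡ X v′ → Y v ≡ Y v′ → v ≡ v′
    ext {v} {v′} x≡ y≡ =
      trans (sym (point-XY v)) (trans (cong₂ point x≡ y≡) (point-XY v′))

    row? : ∀ v → Decidable (λ u → ¬ X u ≡ X v × Y u ≡ Y v)
    row? v u = ¬? (X u Fin.≟ X v) ×-dec (Y u Fin.≟ Y v)

    col? : ∀ v → Decidable (λ u → X u ≡ X v × ¬ Y u ≡ Y v)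
    col? v u = (X u Fin.≟ X v) ×-dec ¬? (Y u Fin.≟ Y v)

    near : VertexSet n m → Vertex n m → ℕ × ℕ
    near A v = ∣ 𝒩ʳ {n} {m} v ∩ A ∣ , ∣ 𝒩ᶜ {n} {m} v ∩ A ∣

    new? : ∀ A → Decidable (λ v → ¬ v ∈ A × ¬ Mem Z (near A v))
    new? A v = ¬? (v ∈? A) ×-dec ¬? (mem? Z (near A v))

  𝒯⁺ : ∀ {A v} → (v ∉ A → ¬ Mem Z (near A v)) → v ∈ 𝒯 {n} {m} Z A
  𝒯⁺ {A} {v} new with v ∈? A
  ... | yes v∈A = x∈p∪q⁺ (inj₁ v∈A)
  ... | no  v∉A = x∈p∪q⁺ (inj₂ (collect⁺ (new? A) (v∉A , new v∉A)))

  𝒯⁻ : ∀ {A v} → v ∈ 𝒯 {n} {m} Z A → v ∈ A ⊎ ¬ Mem Z (near A v)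
  𝒯⁻ {A} v∈ with x∈p∪q⁻ A (collect (new? A)) v∈
  ... | inj₁ v∈A = inj₁ v∈A
  ... | inj₂ v∈  = inj₂ (proj₂ (collect⁻ (new? A) v∈))

  ∩-monoʳ : ∀ {N} (S : Subset N) {A B} → A ⊆ˢ B → S ∩ A ⊆ˢ S ∩ B
  ∩-monoʳ S {A} A⊆B v∈ with x∈p∩q⁻ S A v∈
  ... | v∈S , v∈A = x∈p∩q⁺ (v∈S , A⊆B v∈A)

  𝒯-mono : ∀ {A B} → A ⊆ˢ B → 𝒯 {n} {m} Z A ⊆ˢ 𝒯 {n} {m} Z B
  𝒯-mono A⊆B {v} v∈ with 𝒯⁻ v∈
  ... | inj₁ v∈A = 𝒯⁺ λ v∉B → contradiction (A⊆B v∈A) v∉B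
  ... | inj₂ new = 𝒯⁺ λ _ → new ∘ closed Z
    (p⊆q⇒∣p∣≤∣q∣ (∩-monoʳ (𝒩ʳ {n} {m} v) A⊆B)) (p⊆q⇒∣p∣≤∣q∣ (∩-monoʳ (𝒩ᶜ {n} {m} v) A⊆B))

  𝒯^-mono : ∀ t {A B} → A ⊆ˢ B → T t A ⊆ˢ T t B
  𝒯^-mono zero    A⊆B = A⊆B
  𝒯^-mono (suc t) A⊆B = 𝒯-mono (𝒯^-mono t A⊆B)

  𝒯^-increasing : ∀ t {A} → T t A ⊆ˢ T (suc t) A
  𝒯^-increasing t = p⊆p∪q _

  𝒯^-inflationary : ∀ t {A} → A ⊆ˢ T t A
  𝒯^-inflationary zero        v∈A = v∈A
  𝒯^-inflationary (suc t) {A} v∈A = 𝒯^-increasing t {A} (𝒯^-inflationary t v∈A)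

  private
    rect? : ∀ x k → Decidable (λ v → Fin.toℕ (X v) < x × Fin.toℕ (Y v) < k)
    rect? x k v = (Fin.toℕ (X v) <? x) ×-dec (Fin.toℕ (Y v) <? k)

  ∣rectangle∣≤ : ∀ x k → ∣ collect (rect? x k) ∣ ≤ x * k
  ∣rectangle∣≤ x k = subst (∣ collect (rect? x k) ∣ ≤_) (∣⊤∣≡n (x * k))
    (injection⇒∣∣≤ _ ⊤ place (λ _ → ∈⊤) place-injective)
    where
    place : ∀ {v} → v ∈ collect (rect? x k) → Fin (x * k)
    place v∈ with collect⁻ (rect? x k) v∈
    ... | x< , y< = Fin.combine (Fin.fromℕ< x<) (Fin.fromℕ< y<)

    place-injective : ∀ {v v′} v∈ v′∈ → place {v} v∈ ≡ place {v′} v′∈ → v ≡ v′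
    place-injective v∈ v′∈ eq′ with collect⁻ (rect? x k) v∈ | collect⁻ (rect? x k) v′∈
    ... | x< , y< | x′< , y′< with Fin.combine-injective _ _ _ _ eq′
    ...   | x≡ , y≡ = ext
      (Fin.toℕ-injective (Fin.fromℕ<-injective _ _ x< x′< x≡))
      (Fin.toℕ-injective (Fin.fromℕ<-injective _ _ y< y′< y≡))

  -- All rectangles share the corner (0,0). A vertex of the `x × k` rectangle therefore has `u`
  -- filled points in its row, from the first part, and `w` in its column, from the second.
  Fill⇒spanning : ∀ {t x k c} → Fill (Grow Z n m) t x k c → x ≤ n → k ≤ m →
    ∃[ A ] ∣ A ∣ ≤ c × (∀ {v} → Fin.toℕ (X v) < x → Fin.toℕ (Y v) < k → v ∈ T t A)
  Fill⇒spanning {t} {x} {k} fill x≤n k≤m =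
    collect (rect? x k) , ∣rectangle∣≤ x k ,
    λ x< y< → 𝒯^-inflationary t (collect⁺ (rect? x k) (x< , y<))
  Fill⇒spanning {suc t} {x} {k} (step {u = u} {w} (u≤n , w≤m , ¬mem) F₁ F₂) x≤n k≤m
    with Fill⇒spanning F₁ u≤n k≤m | Fill⇒spanning F₂ x≤n w≤m
  ... | A₁ , A₁≤ , filled₁ | A₂ , A₂≤ , filled₂ =
    A₁ ∪ A₂ , ℕ.≤-trans (∣p∪q∣≤∣p∣+∣q∣ A₁ A₂) (ℕ.+-mono-≤ A₁≤ A₂≤) , λ {v} x< y< →
      𝒯⁺ λ v∉B → ¬mem ∘ closed Z (row≤ y< v∉B) (col≤ x< v∉B)
    where
    B : VertexSet n m
    B = T t (A₁ ∪ A₂)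

    B₁ : ∀ {v} → Fin.toℕ (X v) < u → Fin.toℕ (Y v) < k → v ∈ B
    B₁ x< y< = 𝒯^-mono t (p⊆p∪q A₂) (filled₁ x< y<)

    B₂ : ∀ {v} → Fin.toℕ (X v) < x → Fin.toℕ (Y v) < w → v ∈ B
    B₂ x< y< = 𝒯^-mono t (q⊆p∪q A₁ A₂) (filled₂ x< y<)

    inject≤-< : ∀ {N M} (l : Fin M) (M≤N : M ≤ N) → Fin.toℕ (Fin.inject≤ l M≤N) < M
    inject≤-< {M = M} l M≤N = subst (_< M) (sym (Fin.toℕ-inject≤ l M≤N)) (Fin.toℕ<n l)

    row≤ : ∀ {v} → Fin.toℕ (Y v) < k → v ∉ B → u ≤ ∣ 𝒩ʳ {n} {m} v ∩ B ∣
    row≤ {v} y< v∉B = embedding⇒≤∣∣ _ neighbor neighbor∈ λ eq′ →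
      Fin.inject≤-injective u≤n u≤n _ _ (Fin.combine-injectiveˡ _ (Y v) _ (Y v) eq′)
      where
      neighbor : Fin u → Vertex n m
      neighbor l = point (Fin.inject≤ l u≤n) (Y v)
      X< : ∀ l → Fin.toℕ (X (neighbor l)) < u
      X< l = subst (λ j → Fin.toℕ j < u) (sym (X-point _ (Y v))) (inject≤-< l u≤n)
      neighbor∈ : ∀ l → neighbor l ∈ 𝒩ʳ {n} {m} v ∩ B
      neighbor∈ l = x∈p∩q⁺
        ( collect⁺ (row? v)
            -- An unfilled `v` cannot be one of these filled points, so all `u` of them are proper
            -- neighbors.
            ( (λ x≡ → v∉B (B₁ (subst (λ j → Fin.toℕ j < u) x≡ (X< l)) y<))
            , Y-point _ (Y v) )
        , B₁ (X< l) (subst (λ i → Fin.toℕ i < k) (sym (Y-point _ (Y v))) y<) )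

    col≤ : ∀ {v} → Fin.toℕ (X v) < x → v ∉ B → w ≤ ∣ 𝒩ᶜ {n} {m} v ∩ B ∣
    col≤ {v} x< v∉B = embedding⇒≤∣∣ _ neighbor neighbor∈ λ eq′ →
      Fin.inject≤-injective w≤m w≤m _ _ (Fin.combine-injectiveʳ (X v) _ (X v) _ eq′)
      where
      neighbor : Fin w → Vertex n m
      neighbor l = point (X v) (Fin.inject≤ l w≤m)
      Y< : ∀ l → Fin.toℕ (Y (neighbor l)) < w
      Y< l = subst (λ i → Fin.toℕ i < w) (sym (Y-point (X v) _)) (inject≤-< l w≤m)
      neighbor∈ : ∀ l → neighbor l ∈ 𝒩ᶜ {n} {m} v ∩ B
      neighbor∈ l = x∈p∩q⁺
        ( collect⁺ (col? v)
            ( X-point (X v) _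
            , (λ y≡ → v∉B (B₂ x< (subst (λ i → Fin.toℕ i < w) y≡ (Y< l)))) )
        , B₂ (subst (λ j → Fin.toℕ j < x) (sym (X-point (X v) _)) x<) (Y< l) )

  γ≤Fill : ∀ {L c} → Fill (Grow Z n m) L n m c → γ L Z m n ≤ c
  γ≤Fill {L} F with Fill⇒spanning F ℕ.≤-refl ℕ.≤-refl
  ... | A , A≤ , filled = ℕ.≤-trans
    (IsMinimum.minimal (proj₂ (γ-exists L Z m n)) ∣ A ∣ (A , spans , refl)) A≤
    where
    spans : T L A ≡ ⊤
    spans = ⊆-antisym (⊆-max _) λ _ → filled (Fin.toℕ<n _) (Fin.toℕ<n _)

  private
    row : VertexSet n m → Fin m → ℕ
    row S i = ∣ tabulate (λ j → lookup S (point j i)) ∣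

    col : VertexSet n m → Fin n → ℕ
    col S j = ∣ tabulate (lookup S ∘ point j) ∣

    row≤n : ∀ S i → row S i ≤ n
    row≤n S i = ∣p∣≤n (tabulate (λ j → lookup S (point j i)))

    col≤m : ∀ S j → col S j ≤ m
    col≤m S j = ∣p∣≤n (tabulate (lookup S ∘ point j))

    near-row : ∀ S v → proj₁ (near S v) ≤ row S (Y v)
    near-row S v = injection⇒∣∣≤ _ _ (λ {u} _ → X u)
      (λ {u} u∈ → let u∈𝒩 , u∈S = x∈p∩q⁻ (𝒩ʳ {n} {m} v) S u∈ in
        tabulate-∈⁺ (trans
          (cong (lookup S) (trans (cong (point (X u)) (sym (same u∈𝒩))) (point-XY u)))
          ([]=⇒lookup u∈S)))
      λ u∈ u′∈ x≡ → ext x≡ (trans (same (proj₁ (x∈p∩q⁻ (𝒩ʳ {n} {m} v) S u∈)))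
                         (sym (same (proj₁ (x∈p∩q⁻ (𝒩ʳ {n} {m} v) S u′∈)))))
      where
      same : ∀ {u} → u ∈ 𝒩ʳ {n} {m} v → Y u ≡ Y v
      same u∈ = proj₂ (collect⁻ (row? v) u∈)

    near-col : ∀ S v → proj₂ (near S v) ≤ col S (X v)
    near-col S v = injection⇒∣∣≤ _ _ (λ {u} _ → Y u)
      (λ {u} u∈ → let u∈𝒩 , u∈S = x∈p∩q⁻ (𝒩ᶜ {n} {m} v) S u∈ in
        tabulate-∈⁺ (trans
          (cong (lookup S) (trans (cong (λ j → point j (Y u)) (sym (same u∈𝒩))) (point-XY u)))
          ([]=⇒lookup u∈S)))
      λ u∈ u′∈ y≡ → ext (trans (same (proj₁ (x∈p∩q⁻ (𝒩ᶜ {n} {m} v) S u∈)))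
                      (sym (same (proj₁ (x∈p∩q⁻ (𝒩ᶜ {n} {m} v) S u′∈))))) y≡
      where
      same : ∀ {u} → u ∈ 𝒩ᶜ {n} {m} v → X u ≡ X v
      same u∈ = proj₁ (collect⁻ (col? v) u∈)

    -- The vertex may have joined long before time `suc t`. Row and column counts only increase, and
    -- the complement of `Z` is upward closed, so the counts at time `t` still suffice. For the same
    -- reason whole lines may replace neighborhoods.
    origin : ∀ t {A v} → v ∈ T (suc t) A →
      v ∈ A ⊎ Grow Z n m (row (T t A) (Y v)) (col (T t A) (X v))
    origin t {A} {v} v∈ with 𝒯⁻ v∈
    ... | inj₂ new = inj₂ (row≤n (T t A) (Y v) , col≤m (T t A) (X v) ,
            new ∘ closed Z (near-row (T t A) v) (near-col (T t A) v))
    origin zero    v∈ | inj₁ v∈A = inj₁ v∈A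
    origin (suc t) {A} {v} v∈ | inj₁ v∈′ with origin t {A} v∈′
    ... | inj₁ v∈A = inj₁ v∈A
    ... | inj₂ (_ , _ , ¬mem) =
      inj₂ (row≤n (T (suc t) A) (Y v) , col≤m (T (suc t) A) (X v) , ¬mem ∘ closed Z
        (∣preimage∣-mono (𝒯^-increasing t {A}) (λ j → point j (Y v)))
        (∣preimage∣-mono (𝒯^-increasing t {A}) (point (X v))))

  𝒯^-growth : ∀ A → Growth ∣ A ∣ (Grow Z n m) (λ t i j → lookup (T t A) (point j i))
  𝒯^-growth A = record
    { rows = lines-bound (λ i j → point j i) (λ i j i′ j′ eq′ →
        let j≡ , i≡ = Fin.combine-injective j i j′ i′ eq′ in i≡ , j≡) A
    ; cols = lines-bound point Fin.combine-injective A
    ; grow = λ t {i} {j} b → subst₂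
        (λ i′ j′ → lookup A (point j i) ≡ true ⊎ Grow Z n m (row (T t A) i′) (col (T t A) j′))
        (Y-point j i) (X-point j i) (cases (origin t {A} (lookup⇒[]= (point j i) _ b)))
    }
    where
    cases : ∀ {v} {Q : Set} → v ∈ A ⊎ Q → lookup A v ≡ true ⊎ Q
    cases (inj₁ v∈A) = inj₁ ([]=⇒lookup v∈A)
    cases (inj₂ q)   = inj₂ q

  Fill≤γ : ∀ L → ∃[ c ] Fill (Grow Z n m) L n m c × c ≤ 4 ^ L * γ L Z m n
  Fill≤γ L with IsMinimum.attained (proj₂ (γ-exists L Z m n))
  ... | A , spans , ∣A∣≡γ = let c , F , c≤ = bound in
    c , subst (λ k → Fill (Grow Z n m) L n k c) (∣⊤∣≡n m) F ,
    subst (λ M → c ≤ 4 ^ L * M) ∣A∣≡γ c≤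
    where
    full : ∀ i → row (T L A) i ≡ n
    full i = trans (cong ∣_∣ (⊆-antisym (⊆-max _) λ {j} _ →
      tabulate-∈⁺ ([]=⇒lookup (subst (point j i ∈_) (sym spans) ∈⊤)))) (∣⊤∣≡n n)

    bound : ∃[ c ] Fill (Grow Z n m) L n ∣ ⊤ {m} ∣ c × c ≤ 4 ^ L * ∣ A ∣
    bound = fill-bound (𝒯^-growth A) L ⊤ n λ {i} _ → ℕ.≤-reflexive (sym (full i))

-- Column heights

module _ {P : Pred ℕ 0ℓ} (P? : Decidable P) where

  -- The function `f` generalizes the identity in `upTo`, so that the induction can shift to
  -- `f ∘ suc`.
  length-filter-≤ : ∀ (f : ℕ → ℕ) → (∀ {i j} → i ≤ j → P (f j) → P (f i)) →
    ∀ N w → ¬ P (f w) → length (filter P? (applyUpTo f N)) ≤ w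
  length-filter-≤ f down zero    w ¬P = z≤n
  length-filter-≤ f down (suc N) w ¬P with P? (f 0)
  length-filter-≤ f down (suc N) zero    ¬P | yes P₀ = contradiction P₀ ¬P
  length-filter-≤ f down (suc N) (suc w) ¬P | yes P₀ =
    s≤s (length-filter-≤ (f ∘ suc) (down ∘ s≤s) N w ¬P)
  length-filter-≤ f down (suc N) w       ¬P | no ¬P₀ = ℕ.≤-trans
    (length-filter-≤ (f ∘ suc) (down ∘ s≤s) N 0 (¬P₀ ∘ down z≤n)) z≤n

  length-filter-∉ : ∀ (f : ℕ → ℕ) → (∀ {i j} → i ≤ j → P (f j) → P (f i)) →
    ∀ N → ¬ P (f N) → ¬ P (f (length (filter P? (applyUpTo f N))))
  length-filter-∉ f down zero    ¬P = ¬P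
  length-filter-∉ f down (suc N) ¬P with P? (f 0)
  ... | yes P₀ = length-filter-∉ (f ∘ suc) (down ∘ s≤s) N ¬P
  ... | no ¬P₀ = ¬P₀ ∘ down z≤n

module _ (Z : ZeroSet) {m n a b : ℕ}
         (Z⊆ : Mem Z ⊆ R a b) (a≤n : a ≤ n) (b≤m : b ≤ m) where

  height-least : ∀ {u w} → Grow Z n m u w → height Z m u ≤ w
  height-least {u} {w} (_ , _ , ¬mem) =
    length-filter-≤ (λ y → mem? Z (u , y)) id (closed Z ℕ.≤-refl) m w ¬mem

  -- The case `u = a` is included: this column is empty, and it may be the one at which the search
  -- ends.
  height-grow : ∀ {u} → u ≤ a → Grow Z n m u (height Z m u)
  height-grow {u} u≤a =
    ℕ.≤-trans u≤a a≤n ,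
    ℕ.≤-trans (List.length-filter (λ y → mem? Z (u , y)) (upTo m))
      (ℕ.≤-reflexive (List.length-upTo m)) ,
    length-filter-∉ (λ y → mem? Z (u , y)) id (closed Z ℕ.≤-refl) m
      (λ mem → ℕ.≤⇒≯ b≤m (proj₂ (Z⊆ mem)))

  -- This bounds the number of iterations by `a`, although the program sees only the heights.
  height-positive : ∀ {u} → 0 < height Z m u → u < a
  height-positive {u} pos with mem? Z (u , 0)
  ... | yes mem = proj₁ (Z⊆ mem)
  ... | no ¬mem = contradiction
    (length-filter-≤ (λ y → mem? Z (u , y)) id (closed Z ℕ.≤-refl) m 0 ¬mem) (ℕ.<⇒≱ pos)

-- Execution within a time bound

Runs : Program → State → ℕ → (State → Set) → Set
Runs p σ t Q = ∃[ s ] ∃[ τ ] ⟨ p , σ ⟩⇓[ s ] τ × s ≤ t × Q τ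

infixr 5 _⨟_

_⨟_ : ∀ {p q σ s t} {Q Q′ : State → Set} →
  Runs p σ s Q → (∀ {τ} → Q τ → Runs q τ t Q′) → Runs (p ⨾ q) σ (s + t) Q′
(s , τ , run , s≤ , Qτ) ⨟ next with next Qτ
... | s′ , τ′ , run′ , s′≤ , Qτ′ = s + s′ , τ′ , ⇓seq run run′ , ℕ.+-mono-≤ s≤ s′≤ , Qτ′

Runs-≤ : ∀ {p σ s t} {Q : State → Set} → s ≤ t → Runs p σ s Q → Runs p σ t Q
Runs-≤ s≤t (s′ , τ , run , s′≤ , Qτ) = s′ , τ , run , ℕ.≤-trans s′≤ s≤t , Qτ

Runs-map : ∀ {p σ t} {Q Q′ : State → Set} → (∀ {τ} → Q τ → Q′ τ) →
  Runs p σ t Q → Runs p σ t Q′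
Runs-map f (s , τ , run , s≤ , Qτ) = s , τ , run , s≤ , f Qτ

-- The scalar variable a is the entry of array a at index 0.

infix 6 _≔_

_≔_ : ℕ → Expr → Program
a ≔ e = write a (lit (+ 0)) e

var : ℕ → Expr
var a = read a (lit (+ 0))

value : State → ℕ → ℤ
value σ a = σ a (+ 0)

Frame : (ℕ → Set) → State → State → Set
Frame Kept σ τ = ∀ {a} → Kept a → ∀ i → τ a i ≡ σ a i

update-self : ∀ σ a x → value (update σ a (+ 0) x) a ≡ x
update-self σ a x rewrite dec-true (a ℕ.≟ a) refl = refl

update-other : ∀ σ {a a′} x → a ≢ a′ → ∀ i → update σ a (+ 0) x a′ i ≡ σ a′ i
update-other σ {a} {a′} x a≢ i rewrite dec-false (a ℕ.≟ a′) a≢ = refl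

assign : ∀ {σ} a e → Runs (a ≔ e) σ (2 + exprCost e) λ τ →
  value τ a ≡ eval σ e × Frame (a ≢_) σ τ
assign {σ} a e = _ , _ , ⇓write , ℕ.≤-refl ,
  update-self σ a (eval σ e) , λ a≢ → update-other σ (eval σ e) a≢

-- A program for the recursion

keep-smaller : ℕ → ℕ → ℕ → Program
keep-smaller r c d =
  cond (cmp lt (op add (var c) (var d)) (var r)) (r ≔ op add (var c) (var d)) skip

-- solve t b x y r leaves in r the least cost of filling an x × y rectangle in t
-- steps.  It works on the arrays from b on: b and 1 + b hold the loop variable u
-- and the height of the column that precedes u, 2 + b and 3 + b the costs of the
-- u × y and of the x × height u rectangle.
mutual

  solve : ℕ → ℕ → ℕ → ℕ → ℕ → Program
  solve zero    b x y r = r ≔ op mul (var x) (var y)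
  solve (suc t) b x y r =
    r ≔ op mul (var x) (var y) ⨾
    b ≔ lit (+ 0) ⨾
    suc b ≔ lit (+ 1) ⨾
    while (cmp lt (lit (+ 0)) (var (1 + b))) (search t b x y r)

  search : ℕ → ℕ → ℕ → ℕ → ℕ → Program
  search t b x y r =
    suc b ≔ read 2 (var b) ⨾
    solve t (4 + b) b y (2 + b) ⨾
    solve t (4 + b) x (1 + b) (3 + b) ⨾
    keep-smaller r (2 + b) (3 + b) ⨾
    b ≔ op add (var b) (lit (+ 1))

-- Correctness of the program, with operation counts

keep-smaller-correct : ∀ {σ r c d k C D} →
  value σ r ≡ + k → value σ c ≡ + C → value σ d ≡ + D →
  Runs (keep-smaller r c d) σ 15 λ τ →
    value τ r ≡ + (k ⊓ (C + D)) × Frame (r ≢_) σ τ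
keep-smaller-correct {σ} {r} {c} {d} {k} {C} {D} r≡ c≡ d≡ with C + D <? k
... | yes sum< = let s , τ , run , s≤ , value≡ , F = assign r (op add (var c) (var d)) in
  8 + s , τ , ⇓true (trans test≡ (dec-true (+ (C + D) ℤ.<? + k) (ℤ.+<+ sum<))) run ,
  ℕ.+-monoʳ-≤ 8 s≤ ,
  trans value≡ (trans (cong₂ ℤ._+_ c≡ d≡)
    (cong +_ (sym (ℕ.m≥n⇒m⊓n≡n (ℕ.<⇒≤ sum<))))) , F
  where
  test≡ : holds σ (cmp lt (op add (var c) (var d)) (var r)) ≡ does (+ (C + D) ℤ.<? + k)
  test≡ = cong₂ (λ i j → does (i ℤ.<? j)) (cong₂ ℤ._+_ c≡ d≡) r≡
... | no sum≮ =
  8 + 1 , σ ,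
  ⇓false (trans test≡ (dec-false (+ (C + D) ℤ.<? + k) (sum≮ ∘ ℤ.drop‿+<+))) ⇓skip ,
  ℕ.m≤m+n 9 6 ,
  trans r≡ (cong +_ (sym (ℕ.m≤n⇒m⊓n≡m (ℕ.≮⇒≥ sum≮)))) , λ _ _ → refl
  where
  test≡ : holds σ (cmp lt (op add (var c) (var d)) (var r)) ≡ does (+ (C + D) ℤ.<? + k)
  test≡ = cong₂ (λ i j → does (i ℤ.<? j)) (cong₂ ℤ._+_ c≡ d≡) r≡

-- Here 5 and 6 are the costs of the first and the last assignment in `search`, and 15 = 8 + 7 is a
-- test plus an assignment in `keep-smaller`. In `solveTime`, 4 is the cost of one loop test, and
-- the final 4 pays for the test that fails.
searchTime : ℕ → ℕ
searchTime s = 5 + (s + (s + (15 + 6)))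

solveTime : ℕ → ℕ → ℕ
solveTime a zero    = 7
solveTime a (suc t) = 7 + (2 + 1 + (2 + 1 + (suc a * (4 + searchTime (solveTime a t)) + 4)))

record Layout (b x y r : ℕ) : Set where
  field
    2<b : 2 < b
    x<b : x < b
    y<b : y < b
    r<b : r < b
    2≢r : 2 ≢ r
    x≢r : x ≢ r
    y≢r : y ≢ r

module _ (G : ℕ → ℕ → Set) (h : ℕ → ℕ) (a : ℕ)
         (h-grow : ∀ {u} → u ≤ a → G u (h u))
         (h-least : ∀ {u w} → G u w → h u ≤ w)
         (h-positive : ∀ {u} → 0 < h u → u < a) where

  Heights : State → Set
  Heights σ = ∀ u → σ 2 (+ u) ≡ + h u

  -- Testing the preceding column lets the first empty column still be examined; its choice `w = 0`
  -- dominates every larger `u`. The value 1 makes the loop start.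
  guard : ℕ → ℕ
  guard zero    = 1
  guard (suc u) = h u

  guard-positive : ∀ {u} → 0 < guard u → u ≤ a
  guard-positive {zero}  _   = z≤n
  guard-positive {suc u} pos = h-positive pos

  Kept : ℕ → ℕ → ℕ → Set
  Kept b r a = a < b × a ≢ r

  Solved : ℕ → ℕ → ℕ → ℕ → ℕ → State → State → Set
  Solved t b r X Y σ τ =
    Frame (Kept b r) σ τ × ∃[ c ] value τ r ≡ + c × IsMinimum (Fill G t X Y) c

  record Inv (t b r X Y : ℕ) (σ τ : State) (u k : ℕ) : Set where
    field
      frame    : Frame (Kept b r) σ τ
      u≡       : value τ b ≡ + u
      w≡       : value τ (1 + b) ≡ + guard u
      r≡       : value τ r ≡ + k
      attained : Fill G (suc t) X Y k
      k≤fill   : k ≤ X * Y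
      k≤step   : ∀ {v c d} → v < u → Fill G t v Y c → Fill G t X (h v) d → k ≤ c + d

  -- The last examined column is empty. A step through an examined column `v` can shrink its `w` to
  -- `h v`; a step through a later column is dominated by the last examined one, where both parts
  -- shrink.
  Inv⇒minimum : ∀ {t b r X Y σ τ u k} → Inv t b r X Y σ τ u k → guard u ≡ 0 →
    IsMinimum (Fill G (suc t) X Y) k
  Inv⇒minimum {t} {X = X} {Y} {u = suc u} {k} inv h≡0 =
    record { attained = attained ; minimal = λ _ → minimal }
    where
    open Inv inv
    minimal : ∀ {j} → Fill G (suc t) X Y j → k ≤ j
    minimal fill = k≤fill
    minimal (step {u = v} {w} {c} {d} g F F′) with v <? suc u
    ... | yes v< = let d′ , F″ , d′≤ = Fill-mono ℕ.≤-refl (h-least g) F′ in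
      ℕ.≤-trans (k≤step v< F F″) (ℕ.+-monoʳ-≤ c d′≤)
    ... | no v≮ =
      let c′ , F₁ , c′≤ = Fill-mono (ℕ.<⇒≤ (ℕ.≮⇒≥ v≮)) ℕ.≤-refl F
          d′ , F₂ , d′≤ = Fill-mono ℕ.≤-refl (subst (_≤ w) (sym h≡0) z≤n) F′
      in ℕ.≤-trans (k≤step ℕ.≤-refl F₁ F₂) (ℕ.+-mono-≤ c′≤ d′≤)

  mutual

    solve-correct : ∀ t {b x y r σ X Y} → Layout b x y r → Heights σ →
      value σ x ≡ + X → value σ y ≡ + Y →
      Runs (solve t b x y r) σ (solveTime a t) (Solved t b r X Y σ)
    solve-correct zero {b} {x} {y} {r} {σ} {X} {Y} layout heights x≡ y≡ =
      Runs-map (λ (r≡ , F) →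
          (λ { (_ , a≢r) → F (a≢r ∘ sym) }) ,
          X * Y , trans r≡ (trans (cong₂ ℤ._*_ x≡ y≡) (sym (ℤ.pos-* X Y))) ,
          record { attained = fill ; minimal = λ { _ fill → ℕ.≤-refl } })
        (assign r (op mul (var x) (var y)))
    solve-correct (suc t) {b} {x} {y} {r} {σ} {X} {Y} layout heights x≡ y≡ =
      assign r (op mul (var x) (var y)) ⨟ λ { (r≡ , F₁) →
      assign b (lit (+ 0)) ⨟ λ { (b≡ , F₂) →
      assign (1 + b) (lit (+ 1)) ⨟ λ { (w≡ , F₃) →
      loop t layout heights x≡ y≡ (suc a) refl record
        { frame    = λ { (a<b , a≢r) i →
            trans (F₃ (ℕ.>⇒≢ (ℕ.m<n⇒m<1+n a<b)) i)
              (trans (F₂ (ℕ.>⇒≢ a<b) i) (F₁ (a≢r ∘ sym) i)) }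
        ; u≡       = trans (F₃ ℕ.1+n≢n (+ 0)) b≡
        ; w≡       = w≡
        ; r≡       = trans (F₃ (ℕ.>⇒≢ (ℕ.m<n⇒m<1+n r<b)) (+ 0)) (trans (F₂ (ℕ.>⇒≢ r<b) (+ 0))
            (trans r≡ (trans (cong₂ ℤ._*_ x≡ y≡) (sym (ℤ.pos-* X Y)))))
        ; attained = fill
        ; k≤fill   = ℕ.≤-refl
        ; k≤step   = λ ()
        } } } }
      where open Layout layout

    -- `fuel` counts the columns up to `a` that remain. When it is used up, `u = suc a`, and a
    -- positive guard would contradict `guard-positive`.
    loop : ∀ t {b x y r σ τ X Y u k} → Layout b x y r → Heights σ →
      value σ x ≡ + X → value σ y ≡ + Y →
      ∀ fuel → u + fuel ≡ suc a → Inv t b r X Y σ τ u k →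
      Runs (while (cmp lt (lit (+ 0)) (var (1 + b))) (search t b x y r)) τ
        (fuel * (4 + searchTime (solveTime a t)) + 4) (Solved (suc t) b r X Y σ)
    loop t {b} {τ = τ} {u = u} {k} layout heights x≡ y≡ fuel fuel≡ inv
      with guard u in guard≡
    ... | zero = 4 , τ , ⇓done (cong (λ i → does (+ 0 ℤ.<? i)) w≡0) ,
      ℕ.m≤n+m 4 (fuel * (4 + searchTime (solveTime a t))) ,
      Inv.frame inv , k , Inv.r≡ inv , Inv⇒minimum inv guard≡
      where
      w≡0 : value τ (1 + b) ≡ + 0
      w≡0 = trans (Inv.w≡ inv) (cong +_ guard≡)
    loop t {b} {τ = τ} {u = u} layout heights x≡ y≡ zero fuel≡ inv | suc g =
      contradiction (trans (sym (ℕ.+-identityʳ u)) fuel≡)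
        (ℕ.<⇒≢ (s≤s (guard-positive (subst (0 <_) (sym guard≡) z<s))))
    loop t {b} {τ = τ} {u = u} layout heights x≡ y≡ (suc fuel) fuel≡ inv | suc g =
      let s  , _ , run  , s≤  , _ , inv′ = search-correct t layout heights x≡ y≡ u≤a inv
          s′ , τ′ , run′ , s′≤ , solved =
            loop t layout heights x≡ y≡ fuel (trans (sym (ℕ.+-suc u fuel)) fuel≡) inv′
      in 4 + (s + s′) , τ′ ,
         ⇓loop (cong (λ i → does (+ 0 ℤ.<? i)) w≡suc) run run′ ,
         ℕ.≤-trans (ℕ.+-monoʳ-≤ 4 (ℕ.+-mono-≤ s≤ s′≤))
           (ℕ.≤-reflexive (sym (ℕ.+-assoc (4 + S) (fuel * (4 + S)) 4))) ,
         solved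
      where
      S : ℕ
      S = searchTime (solveTime a t)
      u≤a : u ≤ a
      u≤a = guard-positive (subst (0 <_) (sym guard≡) z<s)
      w≡suc : value τ (1 + b) ≡ + suc g
      w≡suc = trans (Inv.w≡ inv) (cong +_ guard≡)

    search-correct : ∀ t {b x y r σ τ X Y u k} → Layout b x y r → Heights σ →
      value σ x ≡ + X → value σ y ≡ + Y → u ≤ a → Inv t b r X Y σ τ u k →
      Runs (search t b x y r) τ (searchTime (solveTime a t))
        λ τ′ → ∃[ k′ ] Inv t b r X Y σ τ′ (suc u) k′
    search-correct t {b} {x} {y} {r} {σ} {τ} {X} {Y} {u} {k} layout heights x≡ y≡ u≤a inv =
      assign (1 + b) (read 2 (var b)) ⨟ λ { {τ₁} (w₁≡ , F₁) →
      let
        -- Until `keep-smaller` runs, only arrays from `1 + b` on change, so the heights, `x`, `y`,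
        -- `r` and the loop variable survive both recursive calls.
        F≤ : Frame (_< 1 + b) τ τ₁
        F≤ a< = F₁ (ℕ.>⇒≢ a<)
        w₁≡h : value τ₁ (1 + b) ≡ + h u
        w₁≡h = trans w₁≡ (trans (cong (τ 2) u≡) (heights-τ u))
      in
      solve-correct t layoutˡ
        (λ v → trans (F≤ (ℕ.m<n⇒m<1+n 2<b) (+ v)) (heights-τ v))
        (trans (F≤ ℕ.≤-refl (+ 0)) u≡)
        (trans (F≤ (ℕ.m<n⇒m<1+n y<b) (+ 0)) (trans (frame (y<b , y≢r) (+ 0)) y≡)) ⨟
      λ { {τ₂} (F₂ , c , c≡ , c-min) →
      let
        F≤₂ : Frame (_< 1 + b) τ τ₂
        F≤₂ a< i = trans
          (F₂ (ℕ.<-≤-trans a< (ℕ.m≤n+m (1 + b) 3) , ℕ.<⇒≢ (ℕ.m<n⇒m<1+n a<)) i) (F≤ a< i)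
        w₂≡ : value τ₂ (1 + b) ≡ + h u
        w₂≡ = trans (F₂ (ℕ.m≤n+m (2 + b) 2 , ℕ.1+n≢n ∘ sym) (+ 0)) w₁≡h
      in
      solve-correct t layoutʳ
        (λ v → trans (F≤₂ (ℕ.m<n⇒m<1+n 2<b) (+ v)) (heights-τ v))
        (trans (F≤₂ (ℕ.m<n⇒m<1+n x<b) (+ 0)) (trans (frame (x<b , x≢r) (+ 0)) x≡))
        w₂≡ ⨟
      λ { {τ₃} (F₃ , d , d≡ , d-min) →
      let
        F≤₃ : Frame (_< 1 + b) τ τ₃
        F≤₃ a< i = trans
          (F₃ (ℕ.<-≤-trans a< (ℕ.m≤n+m (1 + b) 3) ,
               ℕ.<⇒≢ (ℕ.<-≤-trans a< (ℕ.m≤n+m (1 + b) 2))) i) (F≤₂ a< i)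
        w₃≡ : value τ₃ (1 + b) ≡ + h u
        w₃≡ = trans (F₃ (ℕ.m≤n+m (2 + b) 2 , ℕ.<⇒≢ (ℕ.n≤1+n (2 + b))) (+ 0)) w₂≡
      in
      keep-smaller-correct
        (trans (F≤₃ (ℕ.m<n⇒m<1+n r<b) (+ 0)) r≡)
        (trans (F₃ (ℕ.n≤1+n (3 + b) , ℕ.1+n≢n ∘ sym) (+ 0)) c≡)
        d≡ ⨟
      λ { {τ₄} (r₄≡ , F₄) →
      Runs-map (λ (b₅≡ , F₅) → k ⊓ (c + d) , record
          { frame    = λ { (a<b , a≢r) i →
              trans (F₅ (ℕ.>⇒≢ a<b) i)
                (trans (F₄ (a≢r ∘ sym) i)
                  (trans (F≤₃ (ℕ.m<n⇒m<1+n a<b) i) (frame (a<b , a≢r) i))) }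
          ; u≡       = trans b₅≡ (trans (cong (ℤ._+ + 1)
              (trans (F₄ (ℕ.<⇒≢ r<b) (+ 0)) (trans (F≤₃ ℕ.≤-refl (+ 0)) u≡)))
              (cong +_ (ℕ.+-comm u 1)))
          ; w≡       = trans (F₅ (ℕ.1+n≢n ∘ sym) (+ 0))
              (trans (F₄ (ℕ.<⇒≢ (ℕ.m<n⇒m<1+n r<b)) (+ 0)) w₃≡)
          ; r≡       = trans (F₅ (ℕ.>⇒≢ r<b) (+ 0)) r₄≡
          ; attained = minimum-attained c-min d-min
          ; k≤fill   = ℕ.≤-trans (ℕ.m⊓n≤m k (c + d)) k≤fill
          ; k≤step   = minimum-step c-min d-min
          })
        (assign b (op add (var b) (lit (+ 1)))) } } } }
      where
      open Layout layout
      open Inv inv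

      heights-τ : Heights τ
      heights-τ v = trans (frame (2<b , 2≢r) (+ v)) (heights v)

      layoutˡ : Layout (4 + b) b y (2 + b)
      layoutˡ = record
        { 2<b = ℕ.<-≤-trans 2<b (ℕ.m≤n+m b 4)
        ; x<b = ℕ.m≤n+m (1 + b) 3
        ; y<b = ℕ.<-≤-trans y<b (ℕ.m≤n+m b 4)
        ; r<b = ℕ.n≤1+n (3 + b)
        ; 2≢r = ℕ.<⇒≢ (ℕ.<-≤-trans 2<b (ℕ.m≤n+m b 2))
        ; x≢r = ℕ.<⇒≢ (ℕ.n≤1+n (1 + b))
        ; y≢r = ℕ.<⇒≢ (ℕ.<-≤-trans y<b (ℕ.m≤n+m b 2))
        }

      layoutʳ : Layout (4 + b) x (1 + b) (3 + b)
      layoutʳ = record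
        { 2<b = ℕ.<-≤-trans 2<b (ℕ.m≤n+m b 4)
        ; x<b = ℕ.<-≤-trans x<b (ℕ.m≤n+m b 4)
        ; y<b = ℕ.m≤n+m (2 + b) 2
        ; r<b = ℕ.≤-refl
        ; 2≢r = ℕ.<⇒≢ (ℕ.<-≤-trans 2<b (ℕ.m≤n+m b 3))
        ; x≢r = ℕ.<⇒≢ (ℕ.<-≤-trans x<b (ℕ.m≤n+m b 3))
        ; y≢r = ℕ.<⇒≢ (ℕ.n≤1+n (2 + b))
        }

      minimum-attained : ∀ {c d} →
        IsMinimum (Fill G t u Y) c → IsMinimum (Fill G t X (h u)) d →
        Fill G (suc t) X Y (k ⊓ (c + d))
      minimum-attained {c} {d} c-min d-min with ℕ.⊓-sel k (c + d)
      ... | inj₁ ≡k = subst (Fill G (suc t) X Y) (sym ≡k) attained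
      ... | inj₂ ≡sum = subst (Fill G (suc t) X Y) (sym ≡sum)
        (step (h-grow u≤a) (IsMinimum.attained c-min) (IsMinimum.attained d-min))

      minimum-step : ∀ {c d} →
        IsMinimum (Fill G t u Y) c → IsMinimum (Fill G t X (h u)) d →
        ∀ {v c′ d′} → v < suc u → Fill G t v Y c′ → Fill G t X (h v) d′ →
        k ⊓ (c + d) ≤ c′ + d′
      minimum-step {c} {d} c-min d-min v< F F′ with ℕ.m<1+n⇒m<n∨m≡n v<
      ... | inj₁ v<u  = ℕ.≤-trans (ℕ.m⊓n≤m k (c + d)) (k≤step v<u F F′)
      ... | inj₂ refl = ℕ.≤-trans (ℕ.m⊓n≤n k (c + d))
        (ℕ.+-mono-≤ (IsMinimum.minimal c-min _ F) (IsMinimum.minimal d-min _ F′))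

-- The time bound

-- With P for the previous value, the recursion is 17 + 64xP. Here 17 = 7 + 3 + 3 + 4 is the cost
-- outside the iterations, and 64 = 2 · 32 comes from `suc a ≤ x + x` and from
-- `4 + searchTime s ≤ 32 * P`.
timePolynomial : ℕ → List ℕ
timePolynomial zero    = 7 ∷ []
timePolynomial (suc t) = 17 ∷ map (64 *_) (timePolynomial t)

polynomial-scale : ∀ k cs x → polynomial (map (k *_) cs) x ≡ k * polynomial cs x
polynomial-scale k []       x = sym (ℕ.*-zeroʳ k)
polynomial-scale k (c ∷ cs) x = trans
  (cong (λ z → k * c + x * z) (polynomial-scale k cs x))
  (rearrange k c x (polynomial cs x))
  where
  rearrange : ∀ k c x z → k * c + x * (k * z) ≡ k * (c + x * z)
  rearrange = solve-∀

timePolynomial-positive : ∀ t x → 1 ≤ polynomial (timePolynomial t) x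
timePolynomial-positive zero    x = s≤s z≤n
timePolynomial-positive (suc t) x = s≤s z≤n

solveTime≤ : ∀ t {a x} → a ≤ x → 1 ≤ x → solveTime a t ≤ polynomial (timePolynomial t) x
solveTime≤ zero            a≤x 1≤x = ℕ.m≤m+n 7 _
solveTime≤ (suc t) {a} {x} a≤x 1≤x = begin
  7 + (3 + (3 + (suc a * (4 + searchTime s) + 4)))  ≡⟨ cong (λ z → 7 + (3 + (3 + z)))
                                                          (ℕ.+-comm (suc a * (4 + searchTime s)) 4) ⟩
  17 + suc a * (4 + searchTime s)                   ≤⟨ ℕ.+-monoʳ-≤ 17
                                                          (ℕ.*-mono-≤ (ℕ.+-mono-≤ 1≤x a≤x) search≤) ⟩
  17 + (x + x) * (32 * P)                           ≡⟨ cong (λ z → 17 + z) (rearrange x P) ⟩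
  17 + x * (64 * P)                                 ≡⟨ cong (λ z → 17 + x * z)
                                                          (polynomial-scale 64 (timePolynomial t) x) ⟨
  polynomial (timePolynomial (suc t)) x             ∎
  where
  open ℕ.≤-Reasoning
  s = solveTime a t
  P = polynomial (timePolynomial t) x
  rearrange : ∀ x p → (x + x) * (32 * p) ≡ x * (64 * p)
  rearrange = solve-∀
  regroup : ∀ s → 4 + (5 + (s + (s + (15 + 6)))) ≡ 30 + 2 * s
  regroup = solve-∀
  collect-P : ∀ p → 30 * p + 2 * p ≡ 32 * p
  collect-P = solve-∀
  search≤ : 4 + searchTime s ≤ 32 * P
  search≤ = begin
    4 + searchTime s  ≡⟨ regroup s ⟩
    30 + 2 * s        ≤⟨ ℕ.+-mono-≤ (ℕ.*-monoʳ-≤ 30 (timePolynomial-positive t x))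
                                       (ℕ.*-monoʳ-≤ 2 (solveTime≤ t a≤x 1≤x)) ⟩
    30 * P + 2 * P    ≡⟨ collect-P P ⟩
    32 * P            ∎

theorem1p5 : ∀ (L : ℕ) →
    ∃[ C ] 1 ≤ C ×
    (∃[ p ] ∃[ cs ]
    ∀ (m n a b : ℕ) → 1 ≤ m → 1 ≤ n → 1 ≤ a → 1 ≤ b →
    ∀ (Z : ZeroSet) → Mem Z ⊆ R a b → R a b ⊆ R n m →
    ∃[ t ] ∃[ τ ]
    ⟨ p , input m n Z ⟩⇓[ t ] τ
    × t ≤ polynomial cs (a * b)
    × + γ L Z m n ℤ.≤ output τ
    × output τ ℤ.≤ + (C * γ L Z m n))
theorem1p5 L =
  4 ^ L , ℕ.m^n>0 4 L ,
  solve L 4 1 0 3 ⨾ 0 ≔ var 3 ,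
  -- 5 = 1 + 4: the final copy costs 4, at most four times a polynomial whose value is at least 1.
  map (5 *_) (timePolynomial L) , correct
  where
  correct : ∀ m n a b → 1 ≤ m → 1 ≤ n → 1 ≤ a → 1 ≤ b →
    ∀ Z → Mem Z ⊆ R a b → R a b ⊆ R n m →
    ∃[ t ] ∃[ τ ]
      ⟨ solve L 4 1 0 3 ⨾ 0 ≔ var 3 , input m n Z ⟩⇓[ t ] τ
      × t ≤ polynomial (map (5 *_) (timePolynomial L)) (a * b)
      × + γ L Z m n ℤ.≤ output τ
      × output τ ℤ.≤ + (4 ^ L * γ L Z m n)
  correct m n (suc a) (suc b) _ _ _ _ Z Z⊆ R⊆ =
    Runs-≤ time≤ (solve-correct (Grow Z n m) (height Z m) (suc a)
        (height-grow Z Z⊆ a≤n b≤m) (height-least Z Z⊆ a≤n b≤m) (height-positive Z Z⊆ a≤n b≤m)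
        L layout (λ _ → refl) refl refl ⨟ λ { (_ , c , c≡ , c-min) →
      Runs-map (λ (output≡ , _) →
          let c′ , F , c′≤ = Fill≤γ Z n m L
              output≡c = trans output≡ c≡
          in subst (+ γ L Z m n ℤ.≤_) (sym output≡c)
               (ℤ.+≤+ (γ≤Fill Z n m (IsMinimum.attained c-min))) ,
             subst (ℤ._≤ + (4 ^ L * γ L Z m n)) (sym output≡c)
               (ℤ.+≤+ (ℕ.≤-trans (IsMinimum.minimal c-min c′ F) c′≤)))
        (assign 0 (var 3)) })
    where
    -- As both sides are positive, the rectangle has a top corner, at which the inclusion yields the
    -- inequalities between the sides.
    corner : R (suc a) (suc b) (a , b)
    corner = ℕ.≤-refl , ℕ.≤-refl

    a≤n : suc a ≤ n
    a≤n = proj₁ (R⊆ corner)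

    b≤m : suc b ≤ m
    b≤m = proj₂ (R⊆ corner)

    layout : Layout 4 1 0 3
    layout = record
      { 2<b = s≤s (s≤s (s≤s z≤n)) ; x<b = s≤s (s≤s z≤n) ; y<b = s≤s z≤n ; r<b = ℕ.≤-refl
      ; 2≢r = λ () ; x≢r = λ () ; y≢r = λ () }

    x : ℕ
    x = suc a * suc b

    time≤ : solveTime (suc a) L + 4 ≤ polynomial (map (5 *_) (timePolynomial L)) x
    time≤ = begin
      solveTime (suc a) L + 4  ≤⟨ ℕ.+-mono-≤ (solveTime≤ L (ℕ.m≤m*n (suc a) (suc b)) (s≤s z≤n))
                                              (ℕ.*-monoʳ-≤ 4 (timePolynomial-positive L x)) ⟩
      P + 4 * P                ≡⟨ polynomial-scale 5 (timePolynomial L) x ⟨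
      polynomial (map (5 *_) (timePolynomial L)) x ∎
      where
      open ℕ.≤-Reasoning
      P = polynomial (timePolynomial L) x
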